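{- Let $G$ be a connected graph that is not isomorphic to a path. Let $u$ be a pendant vertex of $G$ adjacent to a cut-vertex $v$ with $\deg(v)=2$. Then $u$ is not a basis forced vertex of $G$.
   Context: All graphs are finite and simple. A pendant is a vertex with exactly one neighbour; a cut-vertex is a vertex $v$ such that $G-v$ is disconnected. For vertices $x,y$ of a connected graph $G$, $d(x,y)$ is the length of a shortest $x$–$y$ path. A set $R\subseteq V(G)$ is a resolving set if for all distinct $x,y\in V(G)$ there is $r\in R$ with $d(r,x)\neq d(r,y)$. The metric dimension $\dim(G)$ is the minimum cardinality of a resolving set, and a resolving set of cardinality $\dim(G)$ is a metric basis. A vertex is a basis forced vertex if it belongs to every metric basis of $G$. -}

module Defs where

open import Data.Fin.Base using (Fin; toℕ; punchIn)
open import Data.Fin.Subset using (Subset; ∣_∣; _∈_)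
open import Data.List.Base using (List; []; _∷_)
open import Data.List.Relation.Unary.Unique.Propositional using (Unique)
open import Data.Nat.Base using (ℕ; suc; _≤_)
open import Data.Nat.Properties using (_≟_; 1+n≢n)
open import Data.Product.Base using (Σ; ∃; ∃₂; _×_)
open import Data.Sum.Base using (_⊎_; inj₁; inj₂; swap)
open import Data.Vec.Base using (tabulate)
open import Function.Base using (_∘_)
open import Function.Bundles using (_⤖_; _⇔_; module Bijection)
open import Level using (0ℓ)
open import Relation.Binary.Core using (Rel)
open import Relation.Binary.Definitions using (Decidable; Symmetric)
open import Relation.Binary.PropositionalEquality using (_≡_; _≢_; sym)
open import Relation.Nullary.Decidable.Core using (does; _⊎-dec_)
open import Relation.Nullary.Negation.Core using (¬_)

-- Finite simple graphs with vertex set Fin n.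
record Graph (n : ℕ) : Set₁ where
  field
    Adj       : Rel (Fin n) 0ℓ
    adj?      : Decidable Adj
    adj-sym   : Symmetric Adj
    adj-irref : ∀ {x} → ¬ Adj x x

open Graph public

private
  variable
    m n : ℕ

infix 4 _≅_

_≅_ : Graph m → Graph n → Set
_≅_ {m} {n} G H = Σ (Fin m ⤖ Fin n) λ f →
  ∀ x y → Adj G x y ⇔ Adj H (Bijection.to f x) (Bijection.to f y)

pathGraph : ∀ n → Graph n
pathGraph n = record
  { Adj       = λ i j → toℕ j ≡ suc (toℕ i) ⊎ toℕ i ≡ suc (toℕ j)
  ; adj?      = λ i j → (toℕ j ≟ suc (toℕ i)) ⊎-dec (toℕ i ≟ suc (toℕ j))
  ; adj-sym   = swap
  ; adj-irref = λ { (inj₁ e) → 1+n≢n (sym e) ; (inj₂ e) → 1+n≢n (sym e) }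
  }

IsPathGraph : Graph n → Set
IsPathGraph G = ∃ λ m → G ≅ pathGraph m

neighbourhood : Graph n → Fin n → Subset n
neighbourhood G v = tabulate λ w → does (adj? G v w)

deg : Graph n → Fin n → ℕ
deg G v = ∣ neighbourhood G v ∣

IsPendant : Graph n → Fin n → Set
IsPendant G u = deg G u ≡ 1

-- Walk G x y k is the type of x–y walks with k edges.
data Walk (G : Graph n) : Fin n → Fin n → ℕ → Set where
  nil  : ∀ {x} → Walk G x x 0
  cons : ∀ {x y z k} → Adj G x y → Walk G y z k → Walk G x z (suc k)

vertices : ∀ {G : Graph n} {x y k} → Walk G x y k → List (Fin n)
vertices {x = x} nil        = x ∷ []
vertices {x = x} (cons _ w) = x ∷ vertices w

Path : Graph n → Fin n → Fin n → ℕ → Set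
Path G x y k = Σ (Walk G x y k) (Unique ∘ vertices)

Connected : Graph n → Set
Connected G = ∀ x y → ∃ λ k → Path G x y k

-- The induced subgraph on the vertices other than v, reindexed by Fin n.
delete : Graph (suc n) → Fin (suc n) → Graph n
delete G v = record
  { Adj       = λ x y → Adj G (punchIn v x) (punchIn v y)
  ; adj?      = λ x y → adj? G (punchIn v x) (punchIn v y)
  ; adj-sym   = adj-sym G
  ; adj-irref = adj-irref G
  }

IsCutVertex : Graph n → Fin n → Set
IsCutVertex {suc n} G v = ¬ Connected (delete G v)

IsMinimum : (ℕ → Set) → ℕ → Set
IsMinimum P k = P k × (∀ j → P j → k ≤ j)

-- "d(x , y) = k".  The relation is functional, and total when G is connected.
Distance : Graph n → Fin n → Fin n → ℕ → Set
Distance G x y = IsMinimum (Path G x y)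

-- "d(r , x) ≠ d(r , y)"
Resolves : Graph n → Fin n → Fin n → Fin n → Set
Resolves G r x y = ∃₂ λ k l → Distance G r x k × Distance G r y l × k ≢ l

IsResolvingSet : Graph n → Subset n → Set
IsResolvingSet G R = ∀ x y → x ≢ y → ∃ λ r → r ∈ R × Resolves G r x y

-- "dim(G) = k"
MetricDimension : Graph n → ℕ → Set
MetricDimension G = IsMinimum λ k → ∃ λ R → IsResolvingSet G R × ∣ R ∣ ≡ k

IsMetricBasis : Graph n → Subset n → Set
IsMetricBasis G R = IsResolvingSet G R × MetricDimension G ∣ R ∣

IsBasisForced : Graph n → Fin n → Set
IsBasisForced G u = ∀ R → IsMetricBasis G R → u ∈ R

{-# OPTIONS --safe #-}
-- Let v be the neighbour of u and R a metric basis containing u.  Since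
-- d(u , x) = 1 + d(v , x) for every x ≠ u, the vertices u and v resolve the
-- same pairs avoiding u.  If R ⊆ {u , v}, then d(u , –) is injective, so it
-- is an isomorphism onto a path.  Otherwise some r ∈ R lies outside {u , v};
-- then (R ∖ {u}) ∪ {v} is again resolving: v resolves every pair {u , y}
-- except when y is the other neighbour of v, and there
-- d(r , u) = d(r , y) + 2.
module Submission where

open import Defs
open import Data.Nat.Base using (ℕ; zero; suc; _+_; _≤_; _<_; z≤n; s≤s; s≤s⁻¹)
open import Data.Nat.Properties as ℕ using (≤-refl; ≤-trans; ≤-antisym; ≤-reflexive; <⇒≢; ≤∧≢⇒<; ≮⇒≥; n≮n; suc-injective; +-comm; +-suc; +-monoʳ-≤; m≤n⇒m≤1+n; module ≤-Reasoning)
open import Data.Nat.Induction using (<-rec)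
open import Data.Fin.Base using (Fin; toℕ; fromℕ<; punchOut)
open import Data.Fin.Properties using (_≟_; any?; injective⇒≤; punchOut-injective; toℕ-injective; toℕ-fromℕ<; toℕ<n)
open import Data.Fin.Subset using (Subset; _∈_; ∣_∣; _∪_; _-_; ⁅_⁆; ⊤; inside; outside)
open import Data.Fin.Subset.Properties using (_∈?_; ∈⊤; x∈⁅x⁆; x∈⁅y⁆⇒x≡y; ∣⁅x⁆∣≡1; x∈p∪q⁻; p⊆p∪q; q⊆p∪q; x∈p∧x≢y⇒x∈p-y; x∈p⇒∣p-x∣<∣p∣; p─q─q≡p─q)
open import Data.List.Membership.DecPropositional using () renaming (_∈?_ to mem?)
import Data.List.Membership.Propositional as List
open import Data.List.Relation.Unary.All using ([])
open import Data.List.Relation.Unary.All.Properties using (¬Any⇒All¬)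
open import Data.List.Relation.Unary.AllPairs using ([]; _∷_)
open import Data.List.Relation.Unary.Any using (here; there)
open import Data.List.Relation.Unary.Unique.Propositional using (Unique)
open import Data.Product.Base using (∃; _×_; _,_; proj₁; proj₂)
open import Data.Sum.Base using (_⊎_; inj₁; inj₂)
open import Data.Vec.Base using ([]; _∷_)
open import Data.Vec.Properties using (lookup⇒[]=; lookup∘tabulate)
open import Function.Base using (_∘_)
open import Function.Bundles using (mk⤖; mk⇔)
open import Function.Consequences.Propositional using (strictlySurjective⇒surjective)
open import Function.Definitions using (Injective; StrictlySurjective)
open import Relation.Binary.Definitions using (tri<; tri≈; tri>)
open import Relation.Binary.PropositionalEquality using (_≡_; _≢_; refl; sym; trans; cong; subst; ≢-sym; module ≡-Reasoning)
open import Relation.Nullary.Decidable using (Dec; yes; no; map′; dec-true; decidable-stable; _×-dec_; ¬?)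
open import Relation.Nullary.Negation.Core using (¬_; contradiction)
open import Relation.Unary using () renaming (Decidable to Decidable₁)

private
  variable
    n : ℕ

-- Least witnesses, finite injections and sizes of subsets.

least : ∀ {P : ℕ → Set} → Decidable₁ P → ∀ k → P k → ∃ (IsMinimum P)
least P? k Pk with P? 0
... | yes P0 = 0 , P0 , λ _ _ → z≤n
least P? zero    P0 | no ¬P0 = contradiction P0 ¬P0
least P? (suc k) Pk | no ¬P0 with m , Pm , min ← least (P? ∘ suc) k Pk =
  suc m , Pm , λ where
    zero    P0 → contradiction P0 ¬P0
    (suc j) Pj → s≤s (min j Pj)

IsMinimum-unique : ∀ {P : ℕ → Set} {k l} → IsMinimum P k → IsMinimum P l → k ≡ l
IsMinimum-unique (Pk , mink) (Pl , minl) = ≤-antisym (mink _ Pl) (minl _ Pk)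

-- A missed value could be punched out of the codomain, leaving an injection from `Fin (suc n)` into
-- `Fin n`.
injective⇒strictlySurjective : ∀ {f : Fin n → Fin n} →
  Injective _≡_ _≡_ f → StrictlySurjective _≡_ f
injective⇒strictlySurjective {suc n} {f} inj j with any? (λ x → f x ≟ j)
... | yes hit = hit
... | no miss = contradiction (injective⇒≤ punched-injective) (n≮n n)
  where
  j≢f : ∀ x → j ≢ f x
  j≢f x j≡fx = miss (x , sym j≡fx)

  punched-injective : Injective _≡_ _≡_ (λ x → punchOut (j≢f x))
  punched-injective {x} {y} eq = inj (punchOut-injective (j≢f x) (j≢f y) eq)

∣p∪q∣≤∣p∣+∣q∣ : ∀ (p q : Subset n) → ∣ p ∪ q ∣ ≤ ∣ p ∣ + ∣ q ∣
∣p∪q∣≤∣p∣+∣q∣ []            []            = z≤n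
∣p∪q∣≤∣p∣+∣q∣ (outside ∷ p) (outside ∷ q) = ∣p∪q∣≤∣p∣+∣q∣ p q
∣p∪q∣≤∣p∣+∣q∣ (outside ∷ p) (inside  ∷ q)
  rewrite +-suc ∣ p ∣ ∣ q ∣ = s≤s (∣p∪q∣≤∣p∣+∣q∣ p q)
∣p∪q∣≤∣p∣+∣q∣ (inside  ∷ p) (outside ∷ q) = s≤s (∣p∪q∣≤∣p∣+∣q∣ p q)
∣p∪q∣≤∣p∣+∣q∣ (inside  ∷ p) (inside  ∷ q) =
  s≤s (≤-trans (∣p∪q∣≤∣p∣+∣q∣ p q) (+-monoʳ-≤ ∣ p ∣ (ℕ.n≤1+n ∣ q ∣)))

-- Removing a member lowers the size, whereas removing `x` a second time changes nothing.
x∉p-x : ∀ (p : Subset n) x → ¬ x ∈ p - x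
x∉p-x p x x∈ = <⇒≢ (x∈p⇒∣p-x∣<∣p∣ x∈) (cong ∣_∣ (p─q─q≡p─q p ⁅ x ⁆))

∈⇒1≤∣p∣ : ∀ {p : Subset n} {x} → x ∈ p → 1 ≤ ∣ p ∣
∈⇒1≤∣p∣ x∈p = ≤-trans (s≤s z≤n) (x∈p⇒∣p-x∣<∣p∣ x∈p)

distinct⇒2≤∣p∣ : ∀ {p : Subset n} {x y} → x ∈ p → y ∈ p → y ≢ x → 2 ≤ ∣ p ∣
distinct⇒2≤∣p∣ x∈p y∈p y≢x =
  ≤-trans (s≤s (∈⇒1≤∣p∣ (x∈p∧x≢y⇒x∈p-y y∈p y≢x))) (x∈p⇒∣p-x∣<∣p∣ x∈p)

distinct⇒3≤∣p∣ : ∀ {p : Subset n} {x y z} → x ∈ p → y ∈ p → z ∈ p →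
  y ≢ x → z ≢ x → z ≢ y → 3 ≤ ∣ p ∣
distinct⇒3≤∣p∣ x∈p y∈p z∈p y≢x z≢x z≢y =
  ≤-trans (s≤s (distinct⇒2≤∣p∣ (x∈p∧x≢y⇒x∈p-y y∈p y≢x) (x∈p∧x≢y⇒x∈p-y z∈p z≢x) z≢y))
          (x∈p⇒∣p-x∣<∣p∣ x∈p)

-- Neighbours at small degree, walks and loop erasure.

module _ (G : Graph n) where

  ∈-neighbourhood : ∀ {x y} → Adj G x y → y ∈ neighbourhood G x
  ∈-neighbourhood {x} {y} a =
    lookup⇒[]= y _ (trans (lookup∘tabulate _ y) (dec-true (adj? G x y) a))

  deg≡1⇒unique-neighbour : ∀ {x} → deg G x ≡ 1 →
    ∀ {y z} → Adj G x y → Adj G x z → z ≡ y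
  deg≡1⇒unique-neighbour deg≡1 {y} {z} xy xz = decidable-stable (z ≟ y) λ z≢y →
    <⇒≢ (distinct⇒2≤∣p∣ (∈-neighbourhood xy) (∈-neighbourhood xz) z≢y) (sym deg≡1)

  deg≡2⇒unique-other-neighbour : ∀ {x} → deg G x ≡ 2 →
    ∀ {w y z} → Adj G x w → Adj G x y → Adj G x z → y ≢ w → z ≢ w → z ≡ y
  deg≡2⇒unique-other-neighbour deg≡2 {y = y} {z} xw xy xz y≢w z≢w =
    decidable-stable (z ≟ y) λ z≢y →
    <⇒≢ (distinct⇒3≤∣p∣ (∈-neighbourhood xw) (∈-neighbourhood xy)
                        (∈-neighbourhood xz) y≢w z≢w z≢y) (sym deg≡2)

  snoc : ∀ {x y z k} → Walk G x y k → Adj G y z → Walk G x z (suc k)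
  snoc nil        b = cons b nil
  snoc (cons a w) b = cons a (snoc w b)

  reverse : ∀ {x y k} → Walk G x y k → Walk G y x k
  reverse nil        = nil
  reverse (cons a w) = snoc (reverse w) (adj-sym G a)

  -- Makes the search for a shortest walk by `least` possible; recursion on the length tries every
  -- first step.
  walk? : ∀ x y → Decidable₁ (Walk G x y)
  walk? x y zero    = map′ (λ { refl → nil }) (λ { nil → refl }) (x ≟ y)
  walk? x y (suc k) =
    map′ (λ { (_ , a , w) → cons a w }) (λ { (cons a w) → _ , a , w })
         (any? λ z → adj? G x z ×-dec walk? z y k)

  suffix : ∀ {x y z k} (w : Walk G y z k) → Unique (vertices w) →
    x List.∈ vertices w → ∃ λ j → j ≤ k × Path G x z j
  suffix nil        uniq       (here refl) = _ , ≤-refl , nil , uniq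
  suffix (cons a w) uniq       (here refl) = _ , ≤-refl , cons a w , uniq
  suffix (cons a w) (_ ∷ uniq) (there x∈w)
    with j , j≤k , p ← suffix w uniq x∈w = j , m≤n⇒m≤1+n j≤k , p

  -- Loop erasure: if `x` already lies on the path obtained from the tail, the suffix starting at
  -- `x` replaces the whole.
  walk⇒path : ∀ {x y k} → Walk G x y k → ∃ λ j → j ≤ k × Path G x y j
  walk⇒path nil = 0 , z≤n , nil , [] ∷ []
  walk⇒path {x} (cons a w) with j , j≤k , p , uniq ← walk⇒path w
    with mem? _≟_ x (vertices p)
  ... | yes x∈p with i , i≤j , q ← suffix p uniq x∈p =
    i , ≤-trans i≤j (m≤n⇒m≤1+n j≤k) , q
  ... | no x∉p = suc j , s≤s j≤k , cons a p , ¬Any⇒All¬ (vertices p) x∉p ∷ uniq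

  -- Allows distances to be computed with walks, which concatenate and reverse freely, although
  -- `Distance` minimises over paths.
  shortest-walk⇒distance : ∀ {x y k} → IsMinimum (Walk G x y) k → Distance G x y k
  shortest-walk⇒distance (w , min) with j , j≤k , p ← walk⇒path w =
    subst (Path G _ _) (≤-antisym j≤k (min j (proj₁ p))) p ,
    λ i q → min i (proj₁ q)

-- The distance function of a connected graph.

module Metric (G : Graph n) (connected : Connected G) where

  -- Abstract so that the endpoints can be inferred from d x y.
  abstract
    shortest-walk : ∀ x y → ∃ (IsMinimum (Walk G x y))
    shortest-walk x y with k , w , _ ← connected x y = least (walk? G x y) k w

  d : Fin n → Fin n → ℕ
  d x y = proj₁ (shortest-walk x y)

  d-walk : ∀ x y → Walk G x y (d x y)
  d-walk x y = proj₁ (proj₂ (shortest-walk x y))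

  d-minimal : ∀ {x y k} → Walk G x y k → d x y ≤ k
  d-minimal {x} {y} = proj₂ (proj₂ (shortest-walk x y)) _

  d-distance : ∀ x y → Distance G x y (d x y)
  d-distance x y = shortest-walk⇒distance G (proj₂ (shortest-walk x y))

  resolves⇒d≢ : ∀ {r x y} → Resolves G r x y → d r x ≢ d r y
  resolves⇒d≢ {r} {x} {y} (k , l , Dx , Dy , k≢l) eq = k≢l (begin
    k      ≡⟨ IsMinimum-unique Dx (d-distance r x) ⟩
    d r x  ≡⟨ eq ⟩
    d r y  ≡⟨ IsMinimum-unique (d-distance r y) Dy ⟩
    l      ∎)
    where open ≡-Reasoning

  d≢⇒resolves : ∀ {r x y} → d r x ≢ d r y → Resolves G r x y
  d≢⇒resolves {r} {x} {y} d≢ = d r x , d r y , d-distance r x , d-distance r y , d≢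

  d-refl : ∀ x → d x x ≡ 0
  d-refl x = ℕ.n≤0⇒n≡0 (d-minimal nil)

  d≡0⇒≡ : ∀ {x y} → d x y ≡ 0 → x ≡ y
  d≡0⇒≡ {x} {y} eq with d x y | d-walk x y
  d≡0⇒≡ refl | _ | nil = refl

  d-sym : ∀ x y → d x y ≡ d y x
  d-sym x y = ≤-antisym (d-minimal (reverse G (d-walk y x)))
                        (d-minimal (reverse G (d-walk x y)))

  d-step : ∀ {x y} → Adj G x y → ∀ z → d x z ≤ suc (d y z)
  d-step a z = d-minimal (cons a (d-walk _ z))

  -- The first edge of a shortest walk leaves a walk of length `k`; by `d-step` nothing shorter is
  -- possible.
  d-first : ∀ {x z k} → d x z ≡ suc k → ∃ λ y → Adj G x y × d y z ≡ k
  d-first {x} {z} {k} eq with subst (Walk G x z) eq (d-walk x z)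
  ... | cons {y = y} a w = y , a , ≤-antisym (d-minimal w)
        (s≤s⁻¹ (≤-trans (≤-reflexive (sym eq)) (d-step a z)))

  -- The level function d(– , u) takes every value below any of its values,
  -- so injectivity makes it a bijection onto {0 , … , n − 1}.
  injective⇒path : ∀ u → Injective _≡_ _≡_ (λ x → d x u) → IsPathGraph G
  injective⇒path u inj = n , mk⤖ (f-injective , strictlySurjective⇒surjective
      (injective⇒strictlySurjective f-injective)) , λ x y → mk⇔ adj⇒ adj⇐
    where
    level : ∀ k x → d x u ≡ k → ∀ i → i ≤ k → ∃ λ y → d y u ≡ i
    level k x eq i i≤k with i ℕ.≟ k
    ... | yes refl = x , eq
    level zero    x eq zero i≤k | no i≢k = contradiction refl i≢k
    level (suc k) x eq i    i≤k | no i≢k with y , _ , eq′ ← d-first eq =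
      level k y eq′ i (s≤s⁻¹ (≤∧≢⇒< i≤k i≢k))

    -- The `suc (d x u)` levels from 0 to `d x u` are attained at distinct vertices, so there are at
    -- most `n` of them.
    d<n : ∀ x → d x u < n
    d<n x = injective⇒≤ at-injective
      where
      at : ∀ (i : Fin (suc (d x u))) → ∃ λ y → d y u ≡ toℕ i
      at i = level (d x u) x refl (toℕ i) (s≤s⁻¹ (toℕ<n i))

      at-injective : Injective _≡_ _≡_ (proj₁ ∘ at)
      at-injective {i} {j} eq = toℕ-injective
        (trans (sym (proj₂ (at i))) (trans (cong (λ y → d y u) eq) (proj₂ (at j))))

    f : Fin n → Fin n
    f x = fromℕ< (d<n x)

    toℕ-f : ∀ x → toℕ (f x) ≡ d x u
    toℕ-f x = toℕ-fromℕ< (d<n x)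

    f-injective : Injective _≡_ _≡_ f
    f-injective {x} {y} eq = inj (trans (sym (toℕ-f x)) (trans (cong toℕ eq) (toℕ-f y)))

    -- The first step from `y` towards `u` lands on the level of `x`, and injectivity leaves only
    -- `x` there.
    successor-adj : ∀ {x y} → d y u ≡ suc (d x u) → Adj G y x
    successor-adj eq with z , a , eq′ ← d-first eq = subst (Adj G _) (inj eq′) a

    adj⇒ : ∀ {x y} → Adj G x y → Adj (pathGraph n) (f x) (f y)
    adj⇒ {x} {y} a rewrite toℕ-f x | toℕ-f y with ℕ.<-cmp (d x u) (d y u)
    ... | tri< lt _ _ = inj₁ (≤-antisym (d-step (adj-sym G a) u) lt)
    ... | tri≈ _ eq _ = contradiction (subst (Adj G x) (sym (inj eq)) a) (adj-irref G)
    ... | tri> _ _ gt = inj₂ (≤-antisym (d-step a u) gt)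

    adj⇐ : ∀ {x y} → Adj (pathGraph n) (f x) (f y) → Adj G x y
    adj⇐ {x} {y} b rewrite toℕ-f x | toℕ-f y with b
    ... | inj₁ eq = adj-sym G (successor-adj eq)
    ... | inj₂ eq = successor-adj eq

  -- Existence of a metric basis.

  ⊤-resolving : IsResolvingSet G ⊤
  ⊤-resolving x y x≢y = x , ∈⊤ , d≢⇒resolves λ eq →
    x≢y (d≡0⇒≡ (trans (sym eq) (d-refl x)))

  -- Stated with a double negation so that no decision procedure for
  -- resolving sets is needed.
  basis-exists : ¬ (∀ R → ¬ IsMetricBasis G R)
  basis-exists no-basis = no-resolving ∣ ⊤ {n} ∣ ⊤ ⊤-resolving refl
    where
    no-resolving : ∀ k R → IsResolvingSet G R → ¬ ∣ R ∣ ≡ k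
    -- Strong induction on the size: if no resolving set is smaller than `R`, then `R` is a metric
    -- basis, contrary to `no-basis`.
    no-resolving = <-rec _ λ where
      _ smaller R res refl → no-basis R (res , (R , res , refl) , λ where
        _ (S , res′ , refl) → ≮⇒≥ λ lt → smaller lt S res′ refl)

-- Distances around the pendant and its neighbour.

module _ (G : Graph n) (connected : Connected G) (¬path : ¬ IsPathGraph G)
         {u v : Fin n} (pendant : IsPendant G u) (uv : Adj G u v)
         (deg-v : deg G v ≡ 2) where

  open Metric G connected

  v≢u : v ≢ u
  v≢u refl = adj-irref G uv

  -- A shortest walk leaving `u` has to start with its only edge, the one to `v`.
  d-pendant : ∀ {x} → x ≢ u → d u x ≡ suc (d v x)
  d-pendant {x} x≢u with d u x in eq
  ... | zero  = contradiction (sym (d≡0⇒≡ eq)) x≢u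
  ... | suc k with y , uy , eq′ ← d-first eq
    with refl ← deg≡1⇒unique-neighbour G pendant uv uy = cong suc (sym eq′)

  d-v-u : d v u ≡ 1
  d-v-u = begin
    d v u        ≡⟨ d-sym v u ⟩
    d u v        ≡⟨ d-pendant v≢u ⟩
    suc (d v v)  ≡⟨ cong suc (d-refl v) ⟩
    1            ∎
    where open ≡-Reasoning

  d-other-neighbour : ∀ {r y} → r ≢ u → r ≢ v → Adj G v y → y ≢ u →
    d v r ≡ suc (d y r)
  d-other-neighbour {r} {y} r≢u r≢v vy y≢u with d v r in eq
  ... | zero  = contradiction (sym (d≡0⇒≡ eq)) r≢v
  ... | suc k with p , vp , eq′ ← d-first eq with p ≟ u
  -- A shortest walk from `v` cannot start towards `u`: it would have to return through `v`, giving
  -- `k ≡ 2 + k`.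
  ...   | yes refl = contradiction
          (trans (sym eq′) (trans (d-pendant r≢u) (cong suc eq)))
          (<⇒≢ (m≤n⇒m≤1+n ≤-refl))
  ...   | no p≢u
    with refl ← deg≡2⇒unique-other-neighbour G deg-v (adj-sym G uv) vy vp y≢u p≢u =
          cong suc (sym eq′)

  -- Every walk from `r` to `u` ends by passing through `y` and then `v`, so equal distances would
  -- give `d y r ≡ 2 + d y r`.
  outsider-resolves : ∀ {r y} → r ≢ u → r ≢ v → Adj G v y → y ≢ u → d r u ≢ d r y
  outsider-resolves {r} {y} r≢u r≢v vy y≢u eq = <⇒≢ (m≤n⇒m≤1+n ≤-refl) (begin
    d y r              ≡⟨ d-sym y r ⟩
    d r y              ≡⟨ eq ⟨
    d r u              ≡⟨ d-sym r u ⟩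
    d u r              ≡⟨ d-pendant r≢u ⟩
    suc (d v r)        ≡⟨ cong suc (d-other-neighbour r≢u r≢v vy y≢u) ⟩
    suc (suc (d y r))  ∎)
    where open ≡-Reasoning

  -- Exchanging the pendant for its neighbour in a basis.

  exchange : Subset n → Subset n
  exchange R = (R - u) ∪ ⁅ v ⁆

  u∉exchange : ∀ R → ¬ u ∈ exchange R
  u∉exchange R u∈ with x∈p∪q⁻ (R - u) ⁅ v ⁆ u∈
  ... | inj₁ u∈R-u = x∉p-x R u u∈R-u
  ... | inj₂ u∈⁅v⁆ = v≢u (sym (x∈⁅y⁆⇒x≡y v u∈⁅v⁆))

  -- An inequality covers the case `v ∈ R` too, and minimality of `R` needs no more.
  ∣exchange∣≤ : ∀ {R} → u ∈ R → ∣ exchange R ∣ ≤ ∣ R ∣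
  ∣exchange∣≤ {R} u∈R = begin
    ∣ exchange R ∣           ≤⟨ ∣p∪q∣≤∣p∣+∣q∣ (R - u) ⁅ v ⁆ ⟩
    ∣ R - u ∣ + ∣ ⁅ v ⁆ ∣    ≡⟨ cong (∣ R - u ∣ +_) (∣⁅x⁆∣≡1 v) ⟩
    ∣ R - u ∣ + 1            ≡⟨ +-comm ∣ R - u ∣ 1 ⟩
    suc ∣ R - u ∣            ≤⟨ x∈p⇒∣p-x∣<∣p∣ u∈R ⟩
    ∣ R ∣                    ∎
    where open ≤-Reasoning

  exchange-resolving : ∀ {R r} → IsResolvingSet G R → r ∈ R → r ≢ u → r ≢ v →
    IsResolvingSet G (exchange R)
  exchange-resolving {R} {r} res r∈R r≢u r≢v x y x≢y = separate (x ≟ u) (y ≟ u)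
    where
    keep : ∀ {s} → s ∈ R → s ≢ u → s ∈ exchange R
    keep s∈R s≢u = p⊆p∪q ⁅ v ⁆ (x∈p∧x≢y⇒x∈p-y s∈R s≢u)

    v∈ : v ∈ exchange R
    v∈ = q⊆p∪q (R - u) ⁅ v ⁆ (x∈⁅x⁆ v)

    from-u : ∀ z → z ≢ u → ∃ λ s → s ∈ exchange R × d s u ≢ d s z
    from-u z z≢u with d v z ℕ.≟ 1
    ... | no d≢1 = v , v∈ , λ eq → d≢1 (trans (sym eq) d-v-u)
    -- Here `z` is a neighbour of `v`, as `u` is, so `v` cannot tell them apart and the outsider `r`
    -- takes over.
    ... | yes d≡1 with p , vp , d≡0 ← d-first d≡1 with refl ← d≡0⇒≡ d≡0 =
      r , keep r∈R r≢u , outsider-resolves r≢u r≢v vp z≢u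

    separate : Dec (x ≡ u) → Dec (y ≡ u) → ∃ λ s → s ∈ exchange R × Resolves G s x y
    separate (yes refl) _ with s , s∈ , d≢ ← from-u y (≢-sym x≢y) =
      s , s∈ , d≢⇒resolves d≢
    separate (no x≢u) (yes refl) with s , s∈ , d≢ ← from-u x x≢u =
      s , s∈ , d≢⇒resolves (≢-sym d≢)
    separate (no x≢u) (no y≢u) with s , s∈R , rs ← res x y x≢y with s ≟ u
    ... | no s≢u = s , keep s∈R s≢u , rs
    -- The lost resolver `u` is replaced by `v`: away from `u` their distances differ by the
    -- constant 1.
    ... | yes refl = v , v∈ , d≢⇒resolves λ eq → resolves⇒d≢ rs
      (trans (d-pendant x≢u) (trans (cong suc eq) (sym (d-pendant y≢u))))

  -- Whatever `v` separates, `u` separates as well, so `u` alone resolves all pairs and its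
  -- distances are injective.
  pair-resolving⇒path : ∀ {R} → IsResolvingSet G R →
    (∀ r → r ∈ R → r ≡ u ⊎ r ≡ v) → IsPathGraph G
  pair-resolving⇒path res R⊆uv = injective⇒path u λ {x} {y} eq →
    decidable-stable (x ≟ y) λ x≢y → separated x y x≢y
      (trans (d-sym u x) (trans eq (d-sym y u)))
    where
    separated : ∀ x y → x ≢ y → d u x ≢ d u y
    separated x y x≢y eq with res x y x≢y
    ... | s , s∈R , rs with R⊆uv s s∈R
    ...   | inj₁ refl = resolves⇒d≢ rs eq
    ...   | inj₂ refl with x ≟ u | y ≟ u
    -- If one vertex of the pair is `u`, the equality puts the other at distance 0 from `u`.
    ...     | yes refl | _        = x≢y (d≡0⇒≡ (trans (sym eq) (d-refl u)))
    ...     | no _     | yes refl = x≢y (sym (d≡0⇒≡ (trans eq (d-refl u))))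
    ...     | no x≢u   | no y≢u   = resolves⇒d≢ rs (suc-injective
              (trans (sym (d-pendant x≢u)) (trans eq (d-pendant y≢u))))

  -- This is where `G` not being a path enters.
  outsider-exists : ∀ {R} → IsResolvingSet G R → ∃ λ r → r ∈ R × r ≢ u × r ≢ v
  outsider-exists {R} res
    with any? (λ r → (r ∈? R) ×-dec (¬? (r ≟ u)) ×-dec (¬? (r ≟ v)))
  ... | yes found = found
  ... | no none = contradiction (pair-resolving⇒path res R⊆uv) ¬path
    where
    R⊆uv : ∀ r → r ∈ R → r ≡ u ⊎ r ≡ v
    R⊆uv r r∈R with r ≟ u | r ≟ v
    ... | yes r≡u | _       = inj₁ r≡u
    ... | no _    | yes r≡v = inj₂ r≡v
    ... | no r≢u  | no r≢v  = contradiction (r , r∈R , r≢u , r≢v) none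

  exchange-basis : ∀ {R} → IsMetricBasis G R → u ∈ R → IsMetricBasis G (exchange R)
  exchange-basis {R} (res , _ , min) u∈R
    with r , r∈R , r≢u , r≢v ← outsider-exists res =
    res′ , (exchange R , res′ , refl) , λ j Pj → ≤-trans (∣exchange∣≤ u∈R) (min j Pj)
    where
    res′ : IsResolvingSet G (exchange R)
    res′ = exchange-resolving res r∈R r≢u r≢v

  -- Forcedness puts `u` in some basis `R` and also in `exchange R`, which avoids it. The goal is a
  -- negation, so the doubly negated existence of `R` is enough.
  pendant-not-forced : ¬ IsBasisForced G u
  pendant-not-forced forced = basis-exists λ R basis →
    u∉exchange R (forced (exchange R) (exchange-basis basis (forced R basis)))

theorem4 : ∀ {n : ℕ} (G : Graph n) → Connected G → ¬ IsPathGraph G →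
    ∀ (u v : Fin n) → IsPendant G u → Adj G u v → IsCutVertex G v → deg G v ≡ 2 →
    ¬ IsBasisForced G u
theorem4 G connected ¬path u v pendant uv _ deg-v =
  pendant-not-forced G connected ¬path pendant uv deg-v
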